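{- For $n\ge0$ let $m_n$ be the number of reduced unit interval graphs on $[n]$; $r_n$ the number of connected reduced unit interval graphs on $[n]$; $t_n$ the number of reduced $2$-nested unit interval graphs on $[n]$; and $f_n$ the number of connected reduced $2$-nested unit interval graphs on $[n]$. Then (i) $m_0=1$ and $m_n=M_{n-1}$ for $n\ge1$, where $M_k$ is the $k$th Motzkin number; (ii) $r_0=0$ and $r_n=R_{n-1}$ for $n\ge1$, where $R_k$ is the $k$th Riordan number; (iii) $t_0=1$, $t_1=1$ and $t_n=2^{n-2}$ for $n\ge2$; (iv) $f_0=0$, $f_1=1$ and $f_n=F_{n-2}$ for $n\ge2$, where $F_k$ is the $k$th Fibonacci number.
   Context: Write $[n]=\{1,\dots,n\}$. An area sequence of size $n$ is a sequence $\mathbf a=(a_1,\dots,a_n)$ of nonnegative integers with $a_i<i$ for all $i$ and $a_i\le a_{i-1}+1$ for all $i\ge 2$. It defines a graph $\Gamma_{\mathbf a}$ on $[n]$ with edges $\{j,i\}$ for $1\le j<i\le n$ with $i-a_i\le j$. The unit interval graphs on $[n]$ are the labeled graphs $\Gamma_{\mathbf a}$, and counting them means counting the corresponding area sequences. For $n=0$ there is a single (empty) graph, which is by convention reduced and $2$-nested but not connected. $\Gamma_{\mathbf a}$ is reduced if there are no two adjacent vertices $j,j+1$ with $N(j)\setminus\{j+1\}=N(j+1)\setminus\{j\}$, where $N(i)$ is the set of neighbors of $i$. If $\{i,j\}$ with $i<j$ is an edge then $\{i,\dots,j\}$ is a clique. A peak-edge is either an isolated vertex $i$ (put $j=i$)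 or an edge $\{i,j\}$, $i<j$, such that neither $\{i,j+1\}$ nor $\{i-1,j\}$ is an edge (pairs not contained in $[n]$ are not edges); the corresponding peak-clique is $\{i,\dots,j\}$. $\Gamma_{\mathbf a}$ is $2$-nested if every vertex lies in at most $2$ peak-cliques. The Motzkin number $M_k$ is the number of Motzkin paths of length $k$, i.e. lattice paths from $(0,0)$ to $(k,0)$ with steps $(1,1),(1,-1),(1,0)$ never going below the $x$-axis. The Riordan number $R_k$ (OEIS A005043: $1,0,1,1,3,6,15,\dots$, $k\ge0$) is the number of Motzkin paths of length $k$ with no horizontal step at height $0$. $F_0=0$, $F_1=1$, $F_k=F_{k-1}+F_{k-2}$. -}

module Defs where

open import Data.Fin.Base using (Fin; toℕ; _<_; _≤_)
open import Data.List.Base using (List; []; _∷_; length; filter; cartesianProductWith)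
open import Data.List.Membership.Propositional using (_∈_)
open import Data.List.Relation.Unary.All using (All)
open import Data.List.Relation.Unary.Unique.Propositional using (Unique)
open import Data.Nat.Base as ℕ using (ℕ; zero; suc; pred; _+_; _∸_)
import Data.Nat.Properties as ℕ
open import Data.Product.Base using (_×_; _,_; ∃-syntax; ∃₂)
open import Data.Sum.Base using (_⊎_)
open import Data.Unit.Base using (⊤; tt)
open import Data.Empty using (⊥)
open import Data.Vec.Base as Vec using (Vec; []; _∷_; lookup)
open import Function.Bundles using (_⇔_)
open import Level using (0ℓ)
open import Relation.Binary.Core using (Rel)
open import Relation.Binary.Construct.Closure.ReflexiveTransitive using (Star)
open import Relation.Binary.Construct.Closure.Symmetric using (SymClosure)
open import Relation.Binary.PropositionalEquality.Core using (_≡_; _≢_)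
open import Relation.Nullary.Decidable using (Dec; yes; no; _×-dec_; ¬?)
open import Relation.Nullary.Negation using (¬_)
open import Relation.Unary using (Pred; _≐_; _∖_; ｛_｝)

-- Exactly k elements satisfy P: they can be listed without repetition in a
-- list of length k.
HasCount : {A : Set} → Pred A 0ℓ → ℕ → Set
HasCount {A} P k =
  ∃[ xs ] Unique xs × (∀ (x : A) → x ∈ xs ⇔ P x) × length xs ≡ k

AtMost : {A : Set} → ℕ → Pred A 0ℓ → Set
AtMost k P = ∀ xs → Unique xs → All P xs → length xs ℕ.≤ k

-- The vertex v ∈ [n] is represented by the i : Fin n with toℕ i = v - 1.
Graph : ℕ → Set₁
Graph n = Rel (Fin n) 0ℓ

-- i is the successor of j as labels.
IsNext : ∀ {n} → Fin n → Fin n → Set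
IsNext j i = toℕ i ≡ suc (toℕ j)

-- With vertices shifted to start at 0, the condition a_v < v reads a_i ≤ i.
IsAreaSequence : ∀ {n} → Pred (Vec ℕ n) 0ℓ
IsAreaSequence a =
  (∀ i → lookup a i ℕ.≤ toℕ i) ×
  (∀ j i → IsNext j i → lookup a i ℕ.≤ lookup a j + 1)

-- The truncated subtraction is exact on area sequences.
Γ : ∀ {n} → Vec ℕ n → Graph n
Γ a = SymClosure λ j i → j < i × toℕ i ∸ lookup a i ℕ.≤ toℕ j

module _ {n : ℕ} (E : Graph n) where

  -- The neighbourhood N(i) is the predicate E i.
  Reduced : Set
  Reduced = ¬ (∃₂ λ j j⁺ →
    IsNext j j⁺ × E j j⁺ × (E j ∖ ｛ j⁺ ｝) ≐ (E j⁺ ∖ ｛ j ｝))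

  Connected : Set
  Connected = 0 ℕ.< n × (∀ i j → Star E i j)

  Isolated : Pred (Fin n) 0ℓ
  Isolated i = ∀ k → ¬ E i k

  PeakEdge : Pred (Fin n × Fin n) 0ℓ
  PeakEdge (i , j) =
    (i ≡ j × Isolated i) ⊎
    (i < j × E i j ×
     (∀ j⁺ → IsNext j j⁺ → ¬ E i j⁺) ×
     (∀ i⁻ → IsNext i⁻ i → ¬ E i⁻ j))

  -- The clique {i,…,j} is represented by its pair of endpoints (i , j), which
  -- it determines, so distinct pairs are distinct cliques.
  PeakCliqueThrough : Fin n → Pred (Fin n × Fin n) 0ℓ
  PeakCliqueThrough v (i , j) = PeakEdge (i , j) × i ≤ v × v ≤ j

  TwoNested : Set
  TwoNested = ∀ v → AtMost 2 (PeakCliqueThrough v)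

-- Unit interval graphs are counted by their area sequences.
CountUnitInterval : ∀ n → (Graph n → Set) → ℕ → Set
CountUnitInterval n P =
  HasCount {Vec ℕ n} (λ a → IsAreaSequence a × P (Γ a))

data Step : Set where
  up down flat : Step

allSteps : List Step
allSteps = up ∷ down ∷ flat ∷ []

allWords : ∀ k → List (Vec Step k)
allWords zero    = [] ∷ []
allWords (suc k) = cartesianProductWith _∷_ allSteps (allWords k)

-- MotzkinFrom h p: the path p started at height h ends at height 0 and never
-- goes below height 0.
MotzkinFrom : ℕ → ∀ {k} → Vec Step k → Set
MotzkinFrom h       []         = h ≡ 0
MotzkinFrom h       (up ∷ p)   = MotzkinFrom (suc h) p
MotzkinFrom zero    (down ∷ p) = ⊥
MotzkinFrom (suc h) (down ∷ p) = MotzkinFrom h p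
MotzkinFrom h       (flat ∷ p) = MotzkinFrom h p

-- No horizontal step at height 0 when p is started at height h.  Only used
-- for paths satisfying MotzkinFrom h, where pred is never applied to 0.
NoFlatAtZeroFrom : ℕ → ∀ {k} → Vec Step k → Set
NoFlatAtZeroFrom h []         = ⊤
NoFlatAtZeroFrom h (up ∷ p)   = NoFlatAtZeroFrom (suc h) p
NoFlatAtZeroFrom h (down ∷ p) = NoFlatAtZeroFrom (pred h) p
NoFlatAtZeroFrom h (flat ∷ p) = h ≢ 0 × NoFlatAtZeroFrom h p

motzkinFrom? : ∀ h {k} (p : Vec Step k) → Dec (MotzkinFrom h p)
motzkinFrom? h       []         = h ℕ.≟ 0
motzkinFrom? h       (up ∷ p)   = motzkinFrom? (suc h) p
motzkinFrom? zero    (down ∷ p) = no λ ()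
motzkinFrom? (suc h) (down ∷ p) = motzkinFrom? h p
motzkinFrom? zero    (flat ∷ p) = motzkinFrom? zero p
motzkinFrom? (suc h) (flat ∷ p) = motzkinFrom? (suc h) p

noFlatAtZeroFrom? : ∀ h {k} (p : Vec Step k) → Dec (NoFlatAtZeroFrom h p)
noFlatAtZeroFrom? h []         = yes tt
noFlatAtZeroFrom? h (up ∷ p)   = noFlatAtZeroFrom? (suc h) p
noFlatAtZeroFrom? h (down ∷ p) = noFlatAtZeroFrom? (pred h) p
noFlatAtZeroFrom? h (flat ∷ p) = ¬? (h ℕ.≟ 0) ×-dec noFlatAtZeroFrom? h p

motzkin : ℕ → ℕ
motzkin k = length (filter (motzkinFrom? 0) (allWords k))

riordan : ℕ → ℕ
riordan k =
  length (filter (λ p → motzkinFrom? 0 p ×-dec noFlatAtZeroFrom? 0 p) (allWords k))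

fib : ℕ → ℕ
fib 0             = 0
fib 1             = 1
fib (suc (suc k)) = fib (suc k) + fib k

{-# OPTIONS --safe #-}
-- Let l(v) = v - a(v) be the leftmost vertex of the clique ending at v, so that l is weakly
-- increasing.  Reducedness says that, for each v ≥ 1, l increases at v or v is a value of l.
-- Read the vertices from left to right, keeping in a queue the values of l that are already
-- passed but still to be taken: a vertex that is only a value enqueues (up), one at which l only
-- increases dequeues (down), and one with both does both (flat).  The queue length traces a
-- Motzkin path.  A flat step at height 0 at v means l(v) = v, a break in connectivity.  The
-- peak-cliques through v start at l(v) and at the queued values, so 2-nested means height ≤ 1;
-- such paths are counted by recursion on their length.

module Submission where

open import Defs
open import Data.Fin.Base as Fin using (Fin; zero; suc; toℕ; fromℕ<; inject₁)
open import Data.Fin.Induction using (<-weakInduction)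
open import Data.Fin.Properties using (any?; pigeonhole; toℕ-fromℕ<; toℕ-injective; toℕ-inject₁; toℕ<n)
open import Data.List.Base using (List; []; _∷_; _∷ʳ_; _++_; length; lookup; map; filter)
open import Data.List.Membership.Propositional using (_∈_)
open import Data.List.Membership.Propositional.Properties
  using (∈-++⁺ˡ; ∈-++⁺ʳ; ∈-++⁻; ∈-lookup; ∈-map⁺; ∈-map⁻; ∈-filter⁺; ∈-filter⁻; ∈-cartesianProductWith⁺)
open import Data.List.Properties using (∷-injective; ∷ʳ-injective; length-++; length-map)
open import Data.List.Relation.Unary.All as All using (All; []; _∷_)
open import Data.List.Relation.Unary.AllPairs using ([]; _∷_)
open import Data.List.Relation.Unary.Any using (here; there; index)
open import Data.List.Relation.Unary.Any.Properties using (lookup-index)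
open import Data.List.Relation.Unary.Unique.Propositional using (Unique)
import Data.List.Relation.Unary.Unique.Propositional.Properties as Unique
open import Data.Nat.Base using (ℕ; zero; suc; pred; _+_; _∸_; _^_; _<_; _≤_; z≤n; s≤s)
open import Data.Nat.Properties
open import Data.Product.Base using (_×_; _,_; ∃; ∃₂; proj₁; proj₂)
open import Data.Sum.Base using (_⊎_; inj₁; inj₂; [_,_]′)
open import Data.Unit.Base using (tt)
open import Data.Vec.Base as Vec using (Vec; []; _∷_)
import Data.Vec.Functional as Vector
import Data.Vec.Properties as Vec
open import Function.Base using (_∘_; id)
open import Function.Bundles using (_⇔_; mk⇔; module Equivalence)
open import Level using (0ℓ)
open import Relation.Binary.Construct.Closure.ReflexiveTransitive using (Star; ε; _◅_; _◅◅_; reverse)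
open import Relation.Binary.Construct.Closure.Symmetric using (SymClosure; fwd; bwd; symmetric)
open import Relation.Binary.Definitions using (tri<; tri≈; tri>)
open import Relation.Binary.PropositionalEquality
open import Relation.Nullary.Decidable using (yes; no; _×-dec_)
open import Relation.Nullary.Negation using (¬_; contradiction)
open import Relation.Unary using (Pred; Decidable; _≐_)

private variable
  b c h k n x : ℕ
  q q₁ q₂ : List ℕ
  s : Step
  w w₁ w₂ : Vec Step k
  l l₁ l₂ : Fin (suc k) → ℕ
  A B : Set

-- Queues as strictly increasing lists

data Chain : ℕ → List ℕ → ℕ → Set where
  end : c < b → Chain c [] b
  _∷_ : c < x → Chain x q b → Chain c (x ∷ q) b

chain⇒< : Chain c q b → c < b
chain⇒< (end c<b)   = c<b
chain⇒< (c<x ∷ x⋯b) = <-trans c<x (chain⇒< x⋯b)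

chain-∈ : Chain c q b → x ∈ q → c < x × x < b
chain-∈ (c<x ∷ x⋯b) (here refl) = c<x , chain⇒< x⋯b
chain-∈ (c<y ∷ y⋯b) (there x∈q) =
  let y<x , x<b = chain-∈ y⋯b x∈q in <-trans c<y y<x , x<b

chain-∉ : Chain c q b → ¬ b ∈ q
chain-∉ c⋯b b∈q = <-irrefl refl (proj₂ (chain-∈ c⋯b b∈q))

chain-push : Chain c q b → Chain c (q ∷ʳ b) (suc b)
chain-push (end c<b)   = c<b ∷ end (n<1+n _)
chain-push (c<x ∷ x⋯b) = c<x ∷ chain-push x⋯b

-- Inverts `chain-push`: in an increasing list below `suc b`, the value `b` can stand only at the
-- end.
chain-unpush : c < b → Chain c q (suc b) →
               Chain c q b ⊎ ∃ λ q₀ → q ≡ q₀ ∷ʳ b × Chain c q₀ b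
chain-unpush c<b (end _) = inj₁ (end c<b)
chain-unpush c<b (c<x ∷ x⋯1+b) with m≤n⇒m<n∨m≡n (≤-pred (chain⇒< x⋯1+b))
... | inj₁ x<b with chain-unpush x<b x⋯1+b
...   | inj₁ x⋯b                = inj₁ (c<x ∷ x⋯b)
...   | inj₂ (q₀ , refl , x⋯b) = inj₂ (_ ∷ q₀ , refl , c<x ∷ x⋯b)
chain-unpush c<b (c<x ∷ end _)       | inj₂ refl = inj₂ ([] , refl , end c<b)
chain-unpush c<b (c<x ∷ (b<y ∷ y⋯)) | inj₂ refl =
  contradiction (≤-trans (s≤s b<y) (chain⇒< y⋯)) (<-irrefl refl)

chain-tail : Chain c (x ∷ q) b → Chain x q b
chain-tail (_ ∷ x⋯b) = x⋯b

chain-head : Chain c (x ∷ q) b → c < x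
chain-head (c<x ∷ _) = c<x

chain-suc : Chain c q b → Chain c q (suc b)
chain-suc (end c<b)   = end (m<n⇒m<1+n c<b)
chain-suc (c<x ∷ x⋯b) = c<x ∷ chain-suc x⋯b

∈-∷ʳ⁻ : x ∈ q ∷ʳ b → x ∈ q ⊎ x ≡ b
∈-∷ʳ⁻ {q = q} x∈ with ∈-++⁻ q x∈
... | inj₁ x∈q         = inj₁ x∈q
... | inj₂ (here refl) = inj₂ refl

length-∷ʳ : ∀ (q : List ℕ) → length (q ∷ʳ x) ≡ suc (length q)
length-∷ʳ q = trans (length-++ q) (+-comm (length q) 1)

-- Runs of the queue and the sequences they read

-- Here l is indexed from vertex b-1, the last one read, and q lists the values in
-- (l zero , b) still to be taken, in increasing order.
data Run : ℕ → List ℕ → ∀ {k} → Vec Step k → (Fin (suc k) → ℕ) → Set where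
  done : Run b [] [] l
  up   : l (suc zero) ≡ l zero →
         Run (suc b) (q ∷ʳ b) w (l ∘ suc) → Run b q (up ∷ w) l
  flat : q ∷ʳ b ≡ l (suc zero) ∷ q₁ →
         Run (suc b) q₁ w (l ∘ suc) → Run b q (flat ∷ w) l
  down : q ≡ l (suc zero) ∷ q₁ →
         Run (suc b) q₁ w (l ∘ suc) → Run b q (down ∷ w) l

up-chain : x ≡ c → Chain c q b → Chain x (q ∷ʳ b) (suc b)
up-chain refl = chain-push

flat-chain : q ∷ʳ b ≡ x ∷ q₁ → Chain c q b → Chain c (x ∷ q₁) (suc b)
flat-chain eq ch = subst (λ q → Chain _ q _) eq (chain-push ch)

down-chain : q ≡ x ∷ q₁ → Chain c q b → Chain c (x ∷ q₁) (suc b)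
down-chain refl ch = chain-suc ch

-- Index `i` stands for the vertex b - 1 + i. Thus `bounded` is l(v) ≤ v, and `taken` is reducedness
-- at the consecutive vertices b + i - 1 and b + i.
record Valid {k} (b : ℕ) (l : Fin (suc k) → ℕ) : Set where
  field
    bounded  : ∀ i → l i < b + toℕ i
    monotone : ∀ {i j} → i Fin.≤ j → l i ≤ l j
    taken    : ∀ i → l (suc i) ≡ l (inject₁ i) → ∃ λ j → l j ≡ b + toℕ i

open Valid

valid-tail : ∀ {l : Fin (suc (suc k)) → ℕ} → Valid b l → Valid (suc b) (l ∘ suc)
valid-tail {b = b} {l = l} v .bounded i = subst (l (suc i) <_) (+-suc b _) (v .bounded (suc i))
valid-tail v .monotone i≤j = v .monotone (s≤s i≤j)
valid-tail {b = b} v .taken i eq with v .taken (suc i) eq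
... | suc j , lⱼ≡ = j , trans lⱼ≡ (+-suc b _)
-- The dropped index cannot be the witness, as its value lies below `b`.
... | zero  , l₀≡ = contradiction
  (subst₂ _<_ l₀≡ (+-identityʳ b) (v .bounded zero))
  (m+n≮m b _)

valid-cons : ∀ {l : Fin (suc (suc k)) → ℕ} →
             l zero < b → l zero ≤ l (suc zero) →
             (l (suc zero) ≡ l zero → ∃ λ j → l (suc j) ≡ b) →
             Valid (suc b) (l ∘ suc) → Valid b l
valid-cons {b = b} l₀<b _ _ v .bounded zero = subst (_ <_) (sym (+-identityʳ b)) l₀<b
valid-cons {b = b} {l = l} _ _ _ v .bounded (suc i) = subst (l (suc i) <_) (sym (+-suc b _)) (v .bounded i)
valid-cons _ _ _ v .monotone {zero} {zero} _ = ≤-refl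
valid-cons _ l₀≤l₁ _ v .monotone {zero} {suc j} _ = ≤-trans l₀≤l₁ (v .monotone z≤n)
valid-cons _ _ _ v .monotone {suc i} {suc j} (s≤s i≤j) = v .monotone i≤j
valid-cons {b = b} _ _ t v .taken zero eq with t eq
... | j , lⱼ≡b = suc j , trans lⱼ≡b (sym (+-identityʳ b))
valid-cons {b = b} _ _ _ v .taken (suc i) eq with v .taken i eq
... | j , lⱼ≡ = suc j , trans lⱼ≡ (sym (+-suc b _))

-- A run ends with an empty queue, so every queued value is dequeued at some later vertex and
-- becomes the value of `l` there.
run-attains : Run b q w l → x ∈ q → ∃ λ j → l (suc j) ≡ x
run-attains (up eq r) x∈q with run-attains r (∈-++⁺ˡ x∈q)
... | j , lⱼ≡x = suc j , lⱼ≡x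
run-attains (flat eq r) x∈q with subst (_ ∈_) eq (∈-++⁺ˡ x∈q)
... | here refl = zero , refl
... | there x∈q₁ with run-attains r x∈q₁
...   | j , lⱼ≡x = suc j , lⱼ≡x
run-attains (down refl r) (here refl) = zero , refl
run-attains (down refl r) (there x∈q) with run-attains r x∈q
... | j , lⱼ≡x = suc j , lⱼ≡x

-- At an `up` step `b` is enqueued, hence attained later. At `flat` and `down` steps `l` strictly
-- increases, the queue lying above `l zero`, so `taken` holds vacuously.
run-valid : Chain (l zero) q b → Run b q w l → Valid b l
run-valid {b = b} ch done .bounded zero = subst (_ <_) (sym (+-identityʳ b)) (chain⇒< ch)
run-valid ch done .monotone {zero} {zero} _ = ≤-refl
run-valid {q = q} ch (up eq r) = valid-cons (chain⇒< ch) (≤-reflexive (sym eq))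
  (λ _ → let j , lⱼ≡b = run-attains r (∈-++⁺ʳ q (here refl)) in suc j , lⱼ≡b)
  (run-valid (up-chain eq ch) r)
run-valid ch (flat eq r) = let ch′ = flat-chain eq ch in
  valid-cons (chain⇒< ch) (<⇒≤ (chain-head ch′))
    (λ l₁≡l₀ → contradiction (sym l₁≡l₀) (<⇒≢ (chain-head ch′)))
    (run-valid (chain-tail ch′) r)
run-valid ch (down eq r) = let ch′ = down-chain eq ch in
  valid-cons (chain⇒< ch) (<⇒≤ (chain-head ch′))
    (λ l₁≡l₀ → contradiction (sym l₁≡l₀) (<⇒≢ (chain-head ch′)))
    (run-valid (chain-tail ch′) r)

-- Converse of `run-attains`: `l` moves only to queue heads, and whatever is enqueued from now on is
-- at least `b`, so a later value below `b` is already waiting.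
run-pending : Chain (l zero) q b → Run b q w l →
              ∀ j → l zero < l j → l j < b → l j ∈ q
run-pending ch r zero l₀<l₀ _ = contradiction l₀<l₀ (<-irrefl refl)
run-pending {l = l} ch (up eq r) (suc j) l₀<lⱼ lⱼ<b
  with ∈-∷ʳ⁻ (run-pending (up-chain eq ch) r j (subst (_< l (suc j)) (sym eq) l₀<lⱼ) (m<n⇒m<1+n lⱼ<b))
... | inj₁ lⱼ∈q = lⱼ∈q
... | inj₂ refl = contradiction lⱼ<b (<-irrefl refl)
run-pending {l = l} {q = q} ch (flat {q₁ = q₁} eq r) (suc j) l₀<lⱼ lⱼ<b
  with ∈-∷ʳ⁻ (subst (l (suc j) ∈_) (sym eq) lⱼ∈)
  where
  ch₁ = chain-tail (flat-chain eq ch)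
  lⱼ∈ : l (suc j) ∈ l (suc zero) ∷ q₁
  lⱼ∈ with m≤n⇒m<n∨m≡n (run-valid ch₁ r .monotone {zero} {j} z≤n)
  ... | inj₁ l₁<lⱼ = there (run-pending ch₁ r j l₁<lⱼ (m<n⇒m<1+n lⱼ<b))
  ... | inj₂ l₁≡lⱼ = here (sym l₁≡lⱼ)
... | inj₁ lⱼ∈q = lⱼ∈q
... | inj₂ lⱼ≡b = contradiction lⱼ<b (<-irrefl lⱼ≡b)
run-pending {l = l} ch (down {q₁ = q₁} refl r) (suc j) l₀<lⱼ lⱼ<b
  with m≤n⇒m<n∨m≡n (run-valid ch₁ r .monotone {zero} {j} z≤n)
  where ch₁ = chain-suc (chain-tail ch)
... | inj₁ l₁<lⱼ = there (run-pending (chain-suc (chain-tail ch)) r j l₁<lⱼ (m<n⇒m<1+n lⱼ<b))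
... | inj₂ l₁≡lⱼ = here (sym l₁≡lⱼ)

-- The queue is recovered from right to left: dequeued values are put back in front,
-- and b is removed from the end.
valid⇒run : ∀ {k} {l : Fin (suc k) → ℕ} → Valid b l → ∃₂ λ q w → Chain (l zero) q b × Run b q w l
valid⇒run {b = b} {zero} v =
  [] , [] , end (subst (_ <_) (+-identityʳ b) (v .bounded zero)) , done
valid⇒run {b = b} {suc k} {l} v
  with valid⇒run (valid-tail v) | m≤n⇒m<n∨m≡n (v .monotone {zero} {suc zero} z≤n)
... | q , w , ch , r | inj₁ l₀<l₁ with chain-unpush l₀<b (l₀<l₁ ∷ ch)
  where l₀<b = subst (_ <_) (+-identityʳ b) (v .bounded zero)
...   | inj₁ ch₀             = l (suc zero) ∷ q , down ∷ w , ch₀ , down refl r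
...   | inj₂ (q₀ , eq , ch₀) = q₀ , flat ∷ w , ch₀ , flat (sym eq) r
valid⇒run {b = b} {suc k} {l} v | q , w , ch , r | inj₂ l₀≡l₁
  with chain-unpush (subst (_< b) l₀≡l₁ l₀<b) ch
  where l₀<b = subst (_ <_) (+-identityʳ b) (v .bounded zero)
... | inj₂ (q₀ , refl , ch₀) =
  q₀ , up ∷ w , subst (λ c → Chain c q₀ b) (sym l₀≡l₁) ch₀ , up (sym l₀≡l₁) r
-- Here `l` is constant at `b` and `b` is absent from the queue. But validity makes `b` a later
-- value, which `run-pending` puts in the queue.
... | inj₁ ch₀ with v .taken zero (sym l₀≡l₁)
...   | zero  , l₀≡b = contradiction (v .bounded zero) (<-irrefl l₀≡b)
...   | suc j , lⱼ≡b+0 = contradiction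
  (subst (_∈ q) lⱼ≡b (run-pending ch r j (subst (_ <_) (sym lⱼ≡b) (chain⇒< ch₀)) (≤-reflexive (cong suc lⱼ≡b))))
  (chain-∉ ch₀)
  where lⱼ≡b = trans lⱼ≡b+0 (+-identityʳ b)

-- The queues are reconstructed from the right along with the words. Whether `l` increases separates
-- `up` from the other steps; whether `b` is in the queue once the dequeued value is put back
-- separates `flat` from `down`.
run-injective : Chain (l zero) q₁ b → Chain (l zero) q₂ b →
                Run b q₁ w₁ l → Run b q₂ w₂ l → q₁ ≡ q₂ × w₁ ≡ w₂
run-injective _ _ done done = refl , refl
run-injective ch₁ ch₂ (up eq₁ r₁) (up eq₂ r₂)
  with run-injective (up-chain eq₁ ch₁) (up-chain eq₂ ch₂) r₁ r₂
... | eq , refl = proj₁ (∷ʳ-injective _ _ eq) , refl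
run-injective ch₁ ch₂ (flat eq₁ r₁) (flat eq₂ r₂)
  with run-injective (chain-tail (flat-chain eq₁ ch₁)) (chain-tail (flat-chain eq₂ ch₂)) r₁ r₂
... | refl , refl = proj₁ (∷ʳ-injective _ _ (trans eq₁ (sym eq₂))) , refl
run-injective ch₁ ch₂ (down refl r₁) (down refl r₂)
  with run-injective (chain-suc (chain-tail ch₁)) (chain-suc (chain-tail ch₂)) r₁ r₂
... | refl , refl = refl , refl
run-injective {q₁ = q₁} ch₁ ch₂ (flat eq₁ r₁) (down refl r₂)
  with run-injective (chain-tail (flat-chain eq₁ ch₁)) (chain-suc (chain-tail ch₂)) r₁ r₂
... | refl , _ = contradiction (subst (_ ∈_) eq₁ (∈-++⁺ʳ q₁ (here refl))) (chain-∉ ch₂)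
run-injective {q₂ = q₂} ch₁ ch₂ (down refl r₁) (flat eq₂ r₂)
  with run-injective (chain-suc (chain-tail ch₁)) (chain-tail (flat-chain eq₂ ch₂)) r₁ r₂
... | refl , _ = contradiction (subst (_ ∈_) eq₂ (∈-++⁺ʳ q₂ (here refl))) (chain-∉ ch₁)
run-injective ch₁ ch₂ (up eq₁ r₁) (flat eq₂ r₂) =
  contradiction (sym eq₁) (<⇒≢ (chain-head (flat-chain eq₂ ch₂)))
run-injective ch₁ ch₂ (up eq₁ r₁) (down eq₂ r₂) =
  contradiction (sym eq₁) (<⇒≢ (chain-head (down-chain eq₂ ch₂)))
run-injective ch₁ ch₂ (flat eq₁ r₁) (up eq₂ r₂) =
  contradiction (sym eq₂) (<⇒≢ (chain-head (flat-chain eq₁ ch₁)))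
run-injective ch₁ ch₂ (down eq₁ r₁) (up eq₂ r₂) =
  contradiction (sym eq₂) (<⇒≢ (chain-head (down-chain eq₁ ch₁)))

run-functional : l₁ zero ≡ l₂ zero → Run b q w l₁ → Run b q w l₂ → l₁ ≗ l₂
run-functional eq _ _ zero = eq
run-functional eq (up eq₁ r₁) (up eq₂ r₂) (suc i) =
  run-functional (trans eq₁ (trans eq (sym eq₂))) r₁ r₂ i
run-functional eq (flat eq₁ r₁) (flat eq₂ r₂) (suc i)
  with ∷-injective (trans (sym eq₁) eq₂)
... | eq′ , refl = run-functional eq′ r₁ r₂ i
run-functional eq (down eq₁ r₁) (down eq₂ r₂) (suc i)
  with ∷-injective (trans (sym eq₁) eq₂)
... | eq′ , refl = run-functional eq′ r₁ r₂ i

run-resp : l₁ ≗ l₂ → Run b q w l₁ → Run b q w l₂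
run-resp eq done       = done
run-resp eq (up e r)   = up (trans (sym (eq _)) (trans e (eq _))) (run-resp (eq ∘ suc) r)
run-resp eq (flat e r) = flat (trans e (cong (_∷ _) (eq _))) (run-resp (eq ∘ suc) r)
run-resp eq (down e r) = down (trans e (cong (_∷ _) (eq _))) (run-resp (eq ∘ suc) r)

-- The height is the queue length: `flat` enqueues one value and dequeues one, and the empty final
-- queue is height 0.
run⇒motzkin : Run b q w l → MotzkinFrom (length q) w
run⇒motzkin done = refl
run⇒motzkin {q = q} (up {w = w} _ r) =
  subst (λ h → MotzkinFrom h w) (length-∷ʳ q) (run⇒motzkin r)
run⇒motzkin {q = q} (flat {w = w} eq r) =
  subst (λ h → MotzkinFrom h w)
    (suc-injective (trans (cong length (sym eq)) (length-∷ʳ q))) (run⇒motzkin r)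
run⇒motzkin (down refl r) = run⇒motzkin r

-- The word is executed on the queue. Staying at nonnegative height guarantees that `down` finds a
-- value to dequeue.
motzkin⇒run : ∀ c b q (w : Vec Step k) → MotzkinFrom (length q) w →
              ∃ λ l → l zero ≡ c × Run b q w l
motzkin⇒run c b [] [] m = (λ _ → c) , refl , done
motzkin⇒run c b q (up ∷ w) m
  with motzkin⇒run c (suc b) (q ∷ʳ b) w (subst (λ h → MotzkinFrom h w) (sym (length-∷ʳ q)) m)
... | l , l₀≡c , r = (c Vector.∷ l) , refl , up l₀≡c r
motzkin⇒run c b (x ∷ q) (down ∷ w) m with motzkin⇒run x (suc b) q w m
... | l , l₀≡x , r = (c Vector.∷ l) , refl , down (cong (_∷ q) (sym l₀≡x)) r
-- On an empty queue `flat` enqueues `b` and takes it at once, so l(b) = b.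
motzkin⇒run c b [] (flat ∷ w) m with motzkin⇒run b (suc b) [] w m
... | l , l₀≡b , r = (c Vector.∷ l) , refl , flat (cong (_∷ []) (sym l₀≡b)) r
motzkin⇒run c b (x ∷ q) (flat ∷ w) m
  with motzkin⇒run x (suc b) (q ∷ʳ b) w (subst (λ h → MotzkinFrom h w) (sym (length-∷ʳ q)) m)
... | l , l₀≡x , r = (c Vector.∷ l) , refl , flat (cong (_∷ _) (sym l₀≡x)) r

-- Pigeonhole for lists without repetition

lookup-distinct : ∀ {A : Set} {xs : List A} → Unique xs →
                  ∀ {i j} → i Fin.< j → lookup xs i ≢ lookup xs j
lookup-distinct (x∉ ∷ xs!) {zero}  {suc j} _         = All.lookup x∉ (∈-lookup j)
lookup-distinct (x∉ ∷ xs!) {suc i} {suc j} (s≤s i<j) = lookup-distinct xs! i<j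

length-≤ : ∀ {A : Set} (f : A → ℕ) {xs : List A} {ys : List ℕ} → Unique xs →
           (∀ {x} → x ∈ xs → f x ∈ ys) →
           (∀ {x y} → x ∈ xs → y ∈ xs → f x ≡ f y → x ≡ y) →
           length xs ≤ length ys
length-≤ f {xs} {ys} xs! f∈ f-inj = ≮⇒≥ λ ys<xs →
  let i , j , i<j , eq = pigeonhole ys<xs (λ i → index (f∈ (∈-lookup i)))
      fᵢ≡fⱼ = trans (lookup-index (f∈ (∈-lookup i)))
             (trans (cong (lookup ys) eq) (sym (lookup-index (f∈ (∈-lookup j)))))
  in lookup-distinct xs! i<j (f-inj (∈-lookup i) (∈-lookup j) fᵢ≡fⱼ)

-- Peak-cliques, reducedness and connectivity

-- At `left a` this unfolds to `Γ a`, so results on monotone `l` apply to unit interval graphs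
-- without conversion.
interval : ∀ {m} → (Fin m → ℕ) → Graph m
interval l = SymClosure λ j i → j Fin.< i × l i ≤ toℕ j

module Interval {m} (l : Fin m → ℕ) (l≤ : ∀ i → l i ≤ toℕ i)
                (mono : ∀ {i j} → i Fin.≤ j → l i ≤ l j) where

  E : Graph m
  E = interval l

  edge⇒l≤ : ∀ {i j} → i Fin.< j → E i j → l j ≤ toℕ i
  edge⇒l≤ _   (fwd (_ , lⱼ≤i)) = lⱼ≤i
  edge⇒l≤ i<j (bwd (j<i , _))  = contradiction i<j (<-asym j<i)

  <-reflects : ∀ {i j} → l i < l j → i Fin.< j
  <-reflects lᵢ<lⱼ = ≰⇒> λ j≤i → <⇒≱ lᵢ<lⱼ (mono j≤i)

  leftmost : ∀ j → ∃ λ i → toℕ i ≡ l j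
  leftmost j = fromℕ< lⱼ<m , toℕ-fromℕ< lⱼ<m
    where lⱼ<m = ≤-<-trans (l≤ j) (toℕ<n j)

  next : ∀ {i : Fin m} → suc (toℕ i) < m → ∃ λ i⁺ → IsNext i i⁺
  next 1+i<m = fromℕ< 1+i<m , toℕ-fromℕ< 1+i<m

  prev : ∀ {m} {i : Fin m} → 0 < toℕ i → ∃ λ i⁻ → IsNext i⁻ i
  prev {i = suc i} _ = inject₁ i , cong suc (sym (toℕ-inject₁ i))

  -- The right end of a level set of `l`; the final vertex qualifies vacuously. Peak-cliques turn
  -- out to be the intervals from `l j` to `j` with `Last j`.
  Last : Fin m → Set
  Last j = ∀ j⁺ → IsNext j j⁺ → l j < l j⁺

  last-increases : ∀ {i j} → Last i → i Fin.< j → l i < l j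
  last-increases last i<j =
    let i⁺ , eq = next (≤-<-trans i<j (toℕ<n _)) in
    <-≤-trans (last i⁺ eq) (mono (≤-trans (≤-reflexive eq) i<j))

  last-unique : ∀ {i j} → Last i → Last j → l i ≡ l j → i ≡ j
  last-unique {i} {j} lastᵢ lastⱼ lᵢ≡lⱼ with <-cmp (toℕ i) (toℕ j)
  ... | tri< i<j _ _ = contradiction lᵢ≡lⱼ (<⇒≢ (last-increases lastᵢ i<j))
  ... | tri≈ _ i≡j _ = toℕ-injective i≡j
  ... | tri> _ _ j<i = contradiction (sym lᵢ≡lⱼ) (<⇒≢ (last-increases lastⱼ j<i))

  last-exists : ∀ j → ∃ λ j′ → j Fin.≤ j′ × l j′ ≡ l j × Last j′
  -- The first argument of `search` is fuel for walking to the right; the bound on `m` shows that it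
  -- cannot run out inside the graph.
  last-exists j = search m j (m≤n+m m (toℕ j))
    where
    search : ∀ d j → m ≤ toℕ j + d → ∃ λ j′ → j Fin.≤ j′ × l j′ ≡ l j × Last j′
    search zero j m≤j =
      contradiction (toℕ<n j) (≤⇒≯ (subst (m ≤_) (+-identityʳ _) m≤j))
    search (suc d) j m≤j+1+d with suc (toℕ j) <? m
    ... | no 1+j≮m = j , ≤-refl , refl , λ j⁺ eq →
      contradiction (subst (_< m) eq (toℕ<n j⁺)) 1+j≮m
    ... | yes 1+j<m with next {j} 1+j<m
    ...   | j⁺ , eq with m≤n⇒m<n∨m≡n (mono {j} {j⁺} (≤-trans (n≤1+n _) (≤-reflexive (sym eq))))
    ...     | inj₁ lⱼ<lⱼ⁺ = j , ≤-refl , refl , λ j⁺⁺ eq′ →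
      subst (λ i → l j < l i) (toℕ-injective (trans eq (sym eq′))) lⱼ<lⱼ⁺
    ...     | inj₂ lⱼ≡lⱼ⁺
      with search d j⁺ (subst (m ≤_) (trans (+-suc _ d) (cong (_+ d) (sym eq))) m≤j+1+d)
    ...       | j′ , j⁺≤j′ , lⱼ′≡ , last =
      j′ , ≤-trans (n≤1+n _) (≤-trans (≤-reflexive (sym eq)) j⁺≤j′) , trans lⱼ′≡ (sym lⱼ≡lⱼ⁺) , last

  -- If `l` did not increase after `j`, the clique would extend to the right; if `l j` were below
  -- `i`, to the left. For an isolated vertex either failure produces a neighbour.
  peak⇒last : ∀ {i j} → PeakEdge E (i , j) → toℕ i ≡ l j × Last j
  peak⇒last {i} (inj₁ (refl , isolated)) = sym lᵢ≡i , λ i⁺ eq → ≰⇒> λ lᵢ⁺≤lᵢ →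
    isolated i⁺ (fwd (≤-reflexive (sym eq) , ≤-trans lᵢ⁺≤lᵢ (l≤ i)))
    where
    lᵢ≡i : l i ≡ toℕ i
    lᵢ≡i with m≤n⇒m<n∨m≡n (l≤ i)
    ... | inj₂ eq = eq
    ... | inj₁ lᵢ<i = let k , k≡lᵢ = leftmost i in
      contradiction (bwd (subst (_< toℕ i) (sym k≡lᵢ) lᵢ<i , ≤-reflexive (sym k≡lᵢ))) (isolated k)
  peak⇒last {i} {j} (inj₂ (i<j , Eij , ¬right , ¬left)) = sym lⱼ≡i , λ j⁺ eq → ≰⇒> λ lⱼ⁺≤lⱼ →
    ¬right j⁺ eq (fwd (<-trans i<j (≤-reflexive (sym eq)) , ≤-trans lⱼ⁺≤lⱼ (edge⇒l≤ i<j Eij)))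
    where
    lⱼ≡i : l j ≡ toℕ i
    lⱼ≡i with m≤n⇒m<n∨m≡n (edge⇒l≤ i<j Eij)
    ... | inj₂ eq = eq
    ... | inj₁ lⱼ<i = let i⁻ , eq = prev {i = i} (≤-<-trans z≤n lⱼ<i) in
      contradiction (fwd (<-trans (≤-reflexive (sym eq)) i<j , ≤-pred (subst (l j <_) eq lⱼ<i)))
                    (¬left i⁻ eq)

  -- The two forms of a peak-edge are told apart by whether `l j` equals `j`.
  last⇒peak : ∀ {i j} → toℕ i ≡ l j → Last j → PeakEdge E (i , j)
  last⇒peak {i} {j} i≡lⱼ last with m≤n⇒m<n∨m≡n (l≤ j)
  ... | inj₂ lⱼ≡j = inj₁ (i≡j , subst (Isolated E) (sym i≡j) isolated)
    where
    i≡j = toℕ-injective (trans i≡lⱼ lⱼ≡j)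
    isolated : Isolated E j
    isolated k (fwd (j<k , lₖ≤j)) =
      <⇒≱ (last-increases last j<k) (subst (l k ≤_) (sym lⱼ≡j) lₖ≤j)
    isolated k (bwd (k<j , lⱼ≤k)) = <⇒≱ k<j (subst (_≤ toℕ k) lⱼ≡j lⱼ≤k)
  ... | inj₁ lⱼ<j = inj₂ (i<j , fwd (i<j , ≤-reflexive (sym i≡lⱼ)) ,
    (λ j⁺ eq e → <⇒≱ (last j⁺ eq)
      (subst (l j⁺ ≤_) i≡lⱼ (edge⇒l≤ (<-trans i<j (≤-reflexive (sym eq))) e))) ,
    (λ i⁻ eq e → let i⁻<i = ≤-reflexive (sym eq) in
      <⇒≱ i⁻<i (subst (_≤ toℕ i⁻) (sym i≡lⱼ) (edge⇒l≤ (<-trans i⁻<i i<j) e))))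
    where i<j = subst (_< toℕ j) (sym i≡lⱼ) lⱼ<j

  -- Moving from `j` to the end of its level keeps the start `l j` and can only enlarge the clique
  -- to the right, so `v` stays inside.
  clique-through : ∀ {v j} → v Fin.≤ j → l j ≤ toℕ v →
                   ∃ λ p → PeakCliqueThrough E v p × toℕ (proj₁ p) ≡ l j
  clique-through {v} {j} v≤j lⱼ≤v =
    let j′ , j≤j′ , lⱼ′≡lⱼ , last = last-exists j
        i , i≡lⱼ = leftmost j
    in (i , j′) ,
       (last⇒peak (trans i≡lⱼ (sym lⱼ′≡lⱼ)) last ,
        subst (_≤ toℕ v) (sym i≡lⱼ) lⱼ≤v , ≤-trans v≤j j≤j′) ,
       i≡lⱼ

  Covers : Fin m → List ℕ → Set
  Covers v q = ∀ j → l v < l j → l j ≤ toℕ v → l j ∈ q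

  -- A peak-clique is determined by its start, by `last-unique`, and the only possible starts are
  -- `l v` and the entries of `q`.
  covers⇒atMost2 : ∀ {v q} → length q ≤ 1 → Covers v q → AtMost 2 (PeakCliqueThrough E v)
  covers⇒atMost2 {v} {q} q≤1 covers ps ps! through =
    ≤-trans (length-≤ (toℕ ∘ proj₁) {ys = l v ∷ q} ps! start∈ start-injective) (s≤s q≤1)
    where
    start∈ : ∀ {p} → p ∈ ps → toℕ (proj₁ p) ∈ l v ∷ q
    start∈ {i , j} p∈ps with All.lookup through p∈ps
    ... | peak , i≤v , v≤j with proj₁ (peak⇒last peak) | m≤n⇒m<n∨m≡n (mono v≤j)
    ...   | i≡lⱼ | inj₂ lᵥ≡lⱼ = here (trans i≡lⱼ (sym lᵥ≡lⱼ))
    ...   | i≡lⱼ | inj₁ lᵥ<lⱼ = there (subst (_∈ q) (sym i≡lⱼ)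
      (covers j lᵥ<lⱼ (subst (_≤ toℕ v) i≡lⱼ i≤v)))
    start-injective : ∀ {p p′} → p ∈ ps → p′ ∈ ps → toℕ (proj₁ p) ≡ toℕ (proj₁ p′) → p ≡ p′
    start-injective p∈ps p′∈ps eq
      with peak⇒last (proj₁ (All.lookup through p∈ps)) | peak⇒last (proj₁ (All.lookup through p′∈ps))
    ... | i≡lⱼ , last | i′≡lⱼ′ , last′ = cong₂ _,_ (toℕ-injective eq)
      (last-unique last last′ (trans (sym i≡lⱼ) (trans eq i′≡lⱼ′)))

  -- Two entries of `q`, together with `l v`, would be the starts of three distinct peak-cliques
  -- through `v`.
  atMost2⇒length≤1 : ∀ {v q} → AtMost 2 (PeakCliqueThrough E v) →
                     Chain (l v) q (suc (toℕ v)) → (∀ {x} → x ∈ q → ∃ λ j → l j ≡ x) →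
                     length q ≤ 1
  atMost2⇒length≤1 {q = []}     _ _ _ = z≤n
  atMost2⇒length≤1 {q = _ ∷ []} _ _ _ = ≤-refl
  atMost2⇒length≤1 {v} {x ∷ y ∷ q} atMost2 (lᵥ<x ∷ x<y ∷ y⋯v) attained =
    let p₀ , t₀ , eq₀ = clique-through {v} ≤-refl (l≤ v)
        j₁ , lⱼ₁≡x = attained (here refl)
        j₂ , lⱼ₂≡y = attained (there (here refl))
        y≤v = ≤-pred (chain⇒< y⋯v)
        p₁ , t₁ , eq₁ = clique-through
          (<⇒≤ (<-reflects (subst (l v <_) (sym lⱼ₁≡x) lᵥ<x)))
          (subst (_≤ toℕ v) (sym lⱼ₁≡x) (≤-trans (<⇒≤ x<y) y≤v))
        p₂ , t₂ , eq₂ = clique-through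
          (<⇒≤ (<-reflects (subst (l v <_) (sym lⱼ₂≡y) (<-trans lᵥ<x x<y))))
          (subst (_≤ toℕ v) (sym lⱼ₂≡y) y≤v)
    in contradiction
         (atMost2 (p₀ ∷ p₁ ∷ p₂ ∷ [])
           ((differ eq₀ (trans eq₁ lⱼ₁≡x) lᵥ<x ∷ differ eq₀ (trans eq₂ lⱼ₂≡y) (<-trans lᵥ<x x<y) ∷ [])
            ∷ (differ (trans eq₁ lⱼ₁≡x) (trans eq₂ lⱼ₂≡y) x<y ∷ []) ∷ [] ∷ [])
           (t₀ ∷ t₁ ∷ t₂ ∷ []))
         λ { (s≤s (s≤s ())) }
    where
    differ : ∀ {p p′ : Fin m × Fin m} {x y} → toℕ (proj₁ p) ≡ x → toℕ (proj₁ p′) ≡ y → x < y → p ≢ p′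
    differ refl refl x<y refl = <-irrefl refl x<y

module _ {k} {l : Fin (suc k) → ℕ} (l≤ : ∀ i → l i ≤ toℕ i)
         (mono : ∀ {i j} → i Fin.≤ j → l i ≤ l j) where

  open Interval l l≤ mono

  -- If `l (suc i)` exceeds `toℕ i`, monotonicity forbids edges from the vertices up to `i` to later
  -- ones, so no path leaves that initial segment.
  connected⇒linked : Connected E → ∀ i → l (suc i) ≤ toℕ i
  connected⇒linked (_ , path) i = ≮⇒≥ λ i<lᵢ₊₁ →
    <⇒≱ (n<1+n _) (confined i<lᵢ₊₁ (path (inject₁ i) (suc i)) (≤-reflexive (toℕ-inject₁ i)))
    where
    confined-edge : toℕ i < l (suc i) → ∀ {x y} → E x y → toℕ x ≤ toℕ i → toℕ y ≤ toℕ i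
    confined-edge i<lᵢ₊₁ (fwd (x<y , ly≤x)) x≤i = ≮⇒≥ λ i<y →
      <⇒≱ (<-≤-trans i<lᵢ₊₁ (mono i<y)) (≤-trans ly≤x x≤i)
    confined-edge i<lᵢ₊₁ (bwd (y<x , _)) x≤i = ≤-trans (<⇒≤ y<x) x≤i
    confined : toℕ i < l (suc i) → ∀ {x y} → Star E x y → toℕ x ≤ toℕ i → toℕ y ≤ toℕ i
    confined h ε x≤i = x≤i
    confined h (e ◅ es) x≤i = confined h es (confined-edge h e x≤i)

  linked⇒connected : (∀ i → l (suc i) ≤ toℕ i) → Connected E
  linked⇒connected linked = s≤s z≤n , λ i j → to-zero i ◅◅ reverse (symmetric _) (to-zero j)
    where
    to-zero : ∀ i → Star E i zero
    to-zero = <-weakInduction _ ε λ i path →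
      bwd (≤-reflexive (cong suc (toℕ-inject₁ i)) , subst (l (suc i) ≤_) (sym (toℕ-inject₁ i)) (linked i)) ◅ path

  -- Equal values of `l` give both vertices the same left neighbours, and a right neighbour `x` can
  -- distinguish them only if `l x` is `suc (toℕ i)`. Without such an `x` the pair violates
  -- reducedness.
  reduced⇒taken : Reduced E → ∀ i → l (suc i) ≡ l (inject₁ i) → ∃ λ j → l j ≡ suc (toℕ i)
  reduced⇒taken reduced i eq with any? (λ j → l j ≟ suc (toℕ i))
  ... | yes found = found
  ... | no ¬found = contradiction
    (inject₁ i , suc i , cong suc (sym i′≡i) , fwd (i<i⁺ , lᵢ⁺≤i) , (λ {x} → to {x}) , λ {x} → from {x}) reduced
    where
    i′≡i = toℕ-inject₁ i
    i<i⁺ : toℕ (inject₁ i) < suc (toℕ i)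
    i<i⁺ = s≤s (≤-reflexive i′≡i)
    lᵢ⁺≤i : l (suc i) ≤ toℕ (inject₁ i)
    lᵢ⁺≤i = subst (_≤ toℕ (inject₁ i)) (sym eq) (l≤ (inject₁ i))
    to : ∀ {x} → E (inject₁ i) x × ¬ suc i ≡ x → E (suc i) x × ¬ inject₁ i ≡ x
    to {x} (fwd (i<x , lₓ≤i) , i⁺≢x) =
      fwd (≤∧≢⇒< (subst (_≤ toℕ x) (cong suc i′≡i) i<x) (i⁺≢x ∘ toℕ-injective) ,
           ≤-trans lₓ≤i (<⇒≤ i<i⁺)) ,
      λ { refl → <-irrefl refl i<x }
    to {x} (bwd (x<i , lᵢ≤x) , _) =
      bwd (<-trans x<i i<i⁺ , subst (_≤ toℕ x) (sym eq) lᵢ≤x) ,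
      λ { refl → <-irrefl refl x<i }
    from : ∀ {x} → E (suc i) x × ¬ inject₁ i ≡ x → E (inject₁ i) x × ¬ suc i ≡ x
    from {x} (fwd (i⁺<x , lₓ≤i⁺) , _) =
      fwd (<-trans i<i⁺ i⁺<x ,
           subst (l x ≤_) (sym i′≡i) (≤-pred (≤∧≢⇒< lₓ≤i⁺ (λ lₓ≡ → ¬found (x , lₓ≡))))) ,
      λ { refl → <-irrefl refl i⁺<x }
    from {x} (bwd (x<i⁺ , lᵢ⁺≤x) , i≢x) =
      bwd (≤∧≢⇒< (subst (toℕ x ≤_) (sym i′≡i) (≤-pred x<i⁺)) (λ x≡i → i≢x (sym (toℕ-injective x≡i))) ,
           subst (_≤ toℕ x) eq lᵢ⁺≤x) ,
      λ { refl → <-irrefl refl x<i⁺ }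

  taken⇒reduced : (∀ i → l (suc i) ≡ l (inject₁ i) → ∃ λ j → l j ≡ suc (toℕ i)) → Reduced E
  taken⇒reduced taken (j , suc i , j⁺≡ , Ejj⁺ , to , from)
    with toℕ-injective (trans (sym (suc-injective j⁺≡)) (sym (toℕ-inject₁ i)))
  ... | refl with m≤n⇒m<n∨m≡n (mono {inject₁ i} {suc i} (<⇒≤ (≤-reflexive (sym j⁺≡))))
  -- The vertex `l j` is a neighbour of `j`, but lies to the left of every neighbour of `suc i`.
  ...   | inj₁ lⱼ<lᵢ⁺ =
    let x , x≡lⱼ = leftmost j
        lᵢ⁺≤j = edge⇒l≤ (≤-reflexive (sym j⁺≡)) Ejj⁺
        x<j = subst (_< toℕ j) (sym x≡lⱼ) (<-≤-trans lⱼ<lᵢ⁺ lᵢ⁺≤j)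
        x<i⁺ = <-trans x<j (≤-reflexive (sym j⁺≡))
    in <⇒≱ lⱼ<lᵢ⁺ (subst (l (suc i) ≤_) x≡lⱼ
         (edge⇒l≤ x<i⁺ (symmetric _ (proj₁ (to (bwd (x<j , ≤-reflexive (sym x≡lⱼ)) ,
            λ i⁺≡x → <-irrefl (cong toℕ (sym i⁺≡x)) x<i⁺))))))
  -- A vertex `x` whose leftmost neighbour is `suc i` is adjacent to `suc i` and not to `j`.
  ...   | inj₂ lⱼ≡lᵢ⁺ with taken i (sym lⱼ≡lᵢ⁺)
  ...     | x , lₓ≡i⁺ = <⇒≱ (≤-reflexive (sym j⁺≡))
    (subst (_≤ toℕ j) lₓ≡i⁺ (edge⇒l≤ (<-trans (≤-reflexive (sym j⁺≡)) i⁺<x)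
      (proj₁ (from (fwd (i⁺<x , ≤-reflexive lₓ≡i⁺) , λ { refl → <⇒≱ i⁺<x (<⇒≤ (≤-reflexive (sym j⁺≡))) })))))
    where
    lᵢ⁺≤j = edge⇒l≤ (≤-reflexive (sym j⁺≡)) Ejj⁺
    i⁺<x : suc (toℕ i) < toℕ x
    i⁺<x = <-reflects {suc i} {x} (subst (l (suc i) <_) (sym lₓ≡i⁺)
      (subst (l (suc i) <_) (sym j⁺≡) (s≤s lᵢ⁺≤j)))

-- Heights of the Motzkin path

-- `pred` matches the descent in `NoFlatAtZeroFrom`; in a run, `down` occurs only at positive
-- height.
after : Step → ℕ → ℕ
after up   = suc
after down = pred
after flat = id

run-step : ∀ {l : Fin (suc (suc k)) → ℕ} → Chain (l zero) q b → Run b q (s ∷ w) l →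
           ∃ λ q₁ → Chain (l (suc zero)) q₁ (suc b) × Run (suc b) q₁ w (l ∘ suc) ×
                    length q₁ ≡ after s (length q)
run-step {q = q} ch (up eq r) = _ , up-chain eq ch , r , length-∷ʳ q
run-step {q = q} ch (flat eq r) = _ , chain-tail (flat-chain eq ch) , r ,
  suc-injective (trans (cong length (sym eq)) (length-∷ʳ q))
run-step ch (down refl r) = _ , chain-suc (chain-tail ch) , r , refl

-- This makes vertex `b` adjacent to its predecessor. Except for `flat` on an empty queue, l(b) is
-- the previous value or a queued one, both below `b`.
run-head< : ∀ {l : Fin (suc (suc k)) → ℕ} → Chain (l zero) q b → Run b q (s ∷ w) l →
            (s ≡ flat → length q ≢ 0) → l (suc zero) < b
run-head< ch (up eq r) _ = subst (_< _) (sym eq) (chain⇒< ch)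
run-head< {q = []}    ch (flat eq r) q≢[] = contradiction refl (q≢[] refl)
run-head< {q = x ∷ q} ch (flat eq r) _ =
  subst (_< _) (proj₁ (∷-injective eq)) (proj₂ (chain-∈ ch (here refl)))
run-head< ch (down refl r) _ = proj₂ (chain-∈ ch (here refl))

noFlat⇒linked : Chain (l zero) q b → Run b q w l → NoFlatAtZeroFrom (length q) w →
                ∀ i → l (suc i) < b + toℕ i
noFlat⇒linked {l = l} {q = q} {b = b} {w = s ∷ w} ch r noFlat zero =
  subst (l (suc zero) <_) (sym (+-identityʳ b)) (run-head< ch r (head s noFlat))
  where
  head : ∀ s → NoFlatAtZeroFrom (length q) (s ∷ w) → s ≡ flat → length q ≢ 0
  head flat (h≢0 , _) _ = h≢0
noFlat⇒linked {l = l} {q = q} {b = b} {w = s ∷ w} ch r noFlat (suc i) with run-step ch r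
... | q₁ , ch₁ , r₁ , len = subst (l (suc (suc i)) <_) (sym (+-suc b _))
  (noFlat⇒linked ch₁ r₁ (subst (λ h → NoFlatAtZeroFrom h w) (sym len) (tail s noFlat)) i)
  where
  tail : ∀ s → NoFlatAtZeroFrom h (s ∷ w) → NoFlatAtZeroFrom (after s h) w
  tail up   = id
  tail down = id
  tail flat = proj₂

linked⇒noFlat : Chain (l zero) q b → Run b q w l → (∀ i → l (suc i) < b + toℕ i) →
                NoFlatAtZeroFrom (length q) w
linked⇒noFlat {w = []} _ _ _ = tt
linked⇒noFlat {l = l} {q = q} {b = b} {w = s ∷ w} ch r linked with run-step ch r
... | q₁ , ch₁ , r₁ , len = cons r (subst (λ h → NoFlatAtZeroFrom h w) len
    (linked⇒noFlat ch₁ r₁ λ i → subst (l (suc (suc i)) <_) (+-suc b _) (linked (suc i))))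
  where
  cons : ∀ {s} → Run b q (s ∷ w) l → NoFlatAtZeroFrom (after s (length q)) w →
         NoFlatAtZeroFrom (length q) (s ∷ w)
  cons (up _ _)   p = p
  cons (down _ _) p = p
  cons (flat eq _) p = (λ len≡0 → nonempty q eq len≡0) , p
    where
    nonempty : ∀ q {q₁} → q ∷ʳ b ≡ l (suc zero) ∷ q₁ → length q ≢ 0
    -- Over an empty queue the value taken is `b` itself, against `linked zero`.
    nonempty [] eq _ =
      <-irrefl (trans (sym (proj₁ (∷-injective eq))) (sym (+-identityʳ b))) (linked zero)

LowFrom : ℕ → ∀ {k} → Vec Step k → Set
LowFrom h []      = h ≤ 1
LowFrom h (s ∷ w) = h ≤ 1 × LowFrom (after s h) w

low⇒≤1 : ∀ (w : Vec Step k) → LowFrom h w → h ≤ 1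
low⇒≤1 []      = id
low⇒≤1 (s ∷ w) = proj₁

-- The witness is the queue just after vertex b - 1 + i is read. It contains the required later
-- values by `run-pending`, while earlier vertices have no larger values.
low⇒covered : Chain (l zero) q b → Run b q w l → LowFrom (length q) w →
              ∀ i → ∃ λ q → length q ≤ 1 × (∀ j → l i < l j → l j < b + toℕ i → l j ∈ q)
low⇒covered {l = l} {q = q} {b = b} {w = w} ch r low zero = q , low⇒≤1 w low , λ j l₀<lⱼ lⱼ<b →
  run-pending ch r j l₀<lⱼ (subst (l j <_) (+-identityʳ b) lⱼ<b)
low⇒covered {l = l} {q = q} {b = b} {w = s ∷ w} ch r (_ , low) (suc i) with run-step ch r
... | q₁ , ch₁ , r₁ , len
  with low⇒covered ch₁ r₁ (subst (λ h → LowFrom h w) (sym len) low) i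
...   | q′ , q′≤1 , covers = q′ , q′≤1 , λ where
  zero    lᵢ<l₀ _    → contradiction (run-valid ch r .monotone {zero} {suc i} z≤n) (<⇒≱ lᵢ<l₀)
  (suc j) lᵢ<lⱼ lⱼ<b → covers j lᵢ<lⱼ (subst (l (suc j) <_) (+-suc b _) lⱼ<b)

-- Each queue met along the run is a chain of attained values, so the hypothesis, shaped after
-- `atMost2⇒length≤1`, bounds every height.
attained⇒low : Chain (l zero) q b → Run b q w l →
               (∀ i q → Chain (l i) q (b + toℕ i) → (∀ {x} → x ∈ q → ∃ λ j → l j ≡ x) →
                length q ≤ 1) →
               LowFrom (length q) w
attained⇒low {l = l} {q = q} {b = b} {w = w} ch r short = go w r
  where
  q≤1 : length q ≤ 1
  q≤1 = short zero q (subst (Chain (l zero) q) (sym (+-identityʳ b)) ch) λ x∈q →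
    let j , eq = run-attains r x∈q in suc j , eq
  go : ∀ w → Run b q w l → LowFrom (length q) w
  go [] r = q≤1
  go (s ∷ w) r with run-step ch r
  ... | q₁ , ch₁ , r₁ , len = q≤1 , subst (λ h → LowFrom h w) len
    (attained⇒low ch₁ r₁ λ i q′ ch′ attained →
      short (suc i) q′ (subst (Chain _ q′) (sym (+-suc b _)) ch′) λ x∈q′ →
        let j , eq = attained x∈q′ in suc j , eq)

-- Area sequences and left ends of cliques

left : Vec ℕ n → Fin n → ℕ
left a i = toℕ i ∸ Vec.lookup a i

left≤ : ∀ (a : Vec ℕ n) i → left a i ≤ toℕ i
left≤ a i = m∸n≤m (toℕ i) (Vec.lookup a i)

monotone-step : ∀ {k} {l : Fin (suc k) → ℕ} → (∀ i → l (inject₁ i) ≤ l (suc i)) →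
                ∀ {i j} → i Fin.≤ j → l i ≤ l j
monotone-step step {zero} {zero} _ = ≤-refl
monotone-step {suc k} step {zero} {suc j} _ =
  ≤-trans (step zero) (monotone-step (step ∘ suc) {zero} {j} z≤n)
monotone-step {suc k} step {suc i} {suc j} (s≤s i≤j) = monotone-step (step ∘ suc) i≤j

-- The index grows by one and the area by at most one, so their difference does not decrease.
left-mono : (a : Vec ℕ (suc n)) → IsAreaSequence a → ∀ {i j} → i Fin.≤ j → left a i ≤ left a j
left-mono a (_ , step) = monotone-step λ i → begin
  toℕ (inject₁ i) ∸ Vec.lookup a (inject₁ i)
    ≡⟨ cong (_∸ Vec.lookup a (inject₁ i)) (toℕ-inject₁ i) ⟩
  suc (toℕ i) ∸ suc (Vec.lookup a (inject₁ i))
    ≡⟨ cong (suc (toℕ i) ∸_) (+-comm 1 (Vec.lookup a (inject₁ i))) ⟩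
  suc (toℕ i) ∸ (Vec.lookup a (inject₁ i) + 1)
    ≤⟨ ∸-monoʳ-≤ (suc (toℕ i)) (step (inject₁ i) (suc i) (cong suc (sym (toℕ-inject₁ i)))) ⟩
  suc (toℕ i) ∸ Vec.lookup a (suc i)
    ∎
  where open ≤-Reasoning

left-injective : {a₁ a₂ : Vec ℕ n} → IsAreaSequence a₁ → IsAreaSequence a₂ →
                 left a₁ ≗ left a₂ → a₁ ≡ a₂
left-injective {a₁ = a₁} {a₂} (a₁≤ , _) (a₂≤ , _) eq =
  trans (sym (Vec.tabulate∘lookup a₁))
 (trans (Vec.tabulate-cong λ i → ∸-cancelˡ-≡ (a₁≤ i) (a₂≤ i) (eq i)) (Vec.tabulate∘lookup a₂))

-- Subtracting from the index is an involution on sequences bounded by the index, so the same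
-- formula inverts `left`.
left-surjective : {l : Fin (suc n) → ℕ} → Valid 1 l →
                  ∃ λ a → IsAreaSequence a × left a ≗ l
left-surjective {l = l} v = a , (a≤ , step) , λ i →
  trans (cong (toℕ i ∸_) (aᵢ≡ i)) (m∸[m∸n]≡n (≤-pred (v .bounded i)))
  where
  a = Vec.tabulate λ i → toℕ i ∸ l i
  aᵢ≡ : ∀ i → Vec.lookup a i ≡ toℕ i ∸ l i
  aᵢ≡ = Vec.lookup∘tabulate λ i → toℕ i ∸ l i
  a≤ : ∀ i → Vec.lookup a i ≤ toℕ i
  a≤ i = subst (_≤ toℕ i) (sym (aᵢ≡ i)) (m∸n≤m (toℕ i) (l i))
  step : ∀ j i → IsNext j i → Vec.lookup a i ≤ Vec.lookup a j + 1
  step j i eq = begin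
    Vec.lookup a i       ≡⟨ aᵢ≡ i ⟩
    toℕ i ∸ l i          ≤⟨ ∸-monoʳ-≤ (toℕ i) (v .monotone (≤-trans (n≤1+n _) (≤-reflexive (sym eq)))) ⟩
    toℕ i ∸ l j          ≡⟨ cong (_∸ l j) (trans eq (+-comm 1 _)) ⟩
    (toℕ j + 1) ∸ l j    ≡⟨ +-∸-comm 1 (≤-pred (v .bounded j)) ⟩
    (toℕ j ∸ l j) + 1    ≡⟨ cong (_+ 1) (aᵢ≡ j) ⟨
    Vec.lookup a j + 1   ∎
    where open ≤-Reasoning

-- Motzkin words encoding reduced graphs

open Equivalence using (to; from)

-- Reading starts after vertex 0, where `l` is forced to be 0: the queue is empty and `b` is 1.
-- Hence n + 1 vertices give a word of length n.
record Encodes (w : Vec Step n) (a : Vec ℕ (suc n)) : Set where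
  constructor encodes
  field
    area : IsAreaSequence a
    run  : Run 1 [] w (left a)

open Encodes

initial : (a : Vec ℕ (suc n)) → Chain (left a zero) [] 1
initial a = end (s≤s (left≤ a zero))

encodes-injective : ∀ {w₁ w₂ : Vec Step n} {a} → Encodes w₁ a → Encodes w₂ a → w₁ ≡ w₂
encodes-injective {a = a} (encodes _ r₁) (encodes _ r₂) =
  proj₂ (run-injective (initial a) (initial a) r₁ r₂)

encodes-functional : {w : Vec Step n} → ∀ {a₁ a₂} → Encodes w a₁ → Encodes w a₂ → a₁ ≡ a₂
encodes-functional {a₁ = a₁} {a₂} (encodes area₁ r₁) (encodes area₂ r₂) =
  left-injective area₁ area₂ (run-functional
    (trans (n≤0⇒n≡0 (left≤ a₁ zero)) (sym (n≤0⇒n≡0 (left≤ a₂ zero)))) r₁ r₂)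

motzkin⇒encodes : (w : Vec Step n) → MotzkinFrom 0 w → ∃ (Encodes w)
motzkin⇒encodes w m with motzkin⇒run 0 1 [] w m
... | l , l₀≡0 , r with left-surjective (run-valid (end (s≤s (≤-reflexive l₀≡0))) r)
...   | a , area , left≗l = a , encodes area (run-resp (λ i → sym (left≗l i)) r)

reduced⇒encodes : (a : Vec ℕ (suc n)) → IsAreaSequence a → Reduced (Γ a) → ∃ λ w → Encodes w a
reduced⇒encodes a area reduced with valid⇒run valid
  where
  valid : Valid 1 (left a)
  valid .bounded i = s≤s (left≤ a i)
  valid .monotone  = left-mono a area
  valid .taken     = reduced⇒taken (left≤ a) (left-mono a area) reduced
... | []    , w , _       , r = w , encodes area r
-- No value fits strictly between `left a zero` and 1, so the initial queue is empty.
... | x ∷ q , w , c<x ∷ ch , r = contradiction (≤-trans (s≤s c<x) (chain⇒< ch)) λ { (s≤s ()) }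

module _ {w : Vec Step n} {a : Vec ℕ (suc n)} (enc : Encodes w a) where

  private
    r = run enc
    mono : ∀ {i j} → i Fin.≤ j → left a i ≤ left a j
    mono = left-mono a (area enc)

  open Interval (left a) (left≤ a) mono using (covers⇒atMost2; atMost2⇒length≤1)

  encodes⇒motzkin : MotzkinFrom 0 w
  encodes⇒motzkin = run⇒motzkin r

  encodes⇒reduced : Reduced (Γ a)
  encodes⇒reduced = taken⇒reduced (left≤ a) mono (run-valid (initial a) r .taken)

  connected⇔noFlat : Connected (Γ a) ⇔ NoFlatAtZeroFrom 0 w
  connected⇔noFlat = mk⇔
    (λ conn → linked⇒noFlat (initial a) r λ i → s≤s (connected⇒linked (left≤ a) mono conn i))
    (λ noFlat → linked⇒connected (left≤ a) mono λ i → ≤-pred (noFlat⇒linked (initial a) r noFlat i))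

  twoNested⇔low : TwoNested (Γ a) ⇔ LowFrom 0 w
  twoNested⇔low = mk⇔
    (λ nested → attained⇒low (initial a) r λ v q → atMost2⇒length≤1 (nested v))
    (λ low v → let q , q≤1 , covers = low⇒covered (initial a) r low v in
      covers⇒atMost2 q≤1 λ j lᵥ<lⱼ lⱼ≤v → covers j lᵥ<lⱼ (s≤s lⱼ≤v))

-- Counting

-- A bijection given as a relation, which spares defining the encoding outside Motzkin words and
-- reduced graphs.
count-related : {P : Pred A 0ℓ} {Q : Pred B 0ℓ} (R : A → B → Set) →
                (∀ {x} → P x → ∃ λ y → R x y × Q y) →
                (∀ {y} → Q y → ∃ λ x → R x y × P x) →
                (∀ {x y₁ y₂} → R x y₁ → R x y₂ → y₁ ≡ y₂) →
                (∀ {x₁ x₂ y} → R x₁ y → R x₂ y → x₁ ≡ x₂) →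
                HasCount P k → HasCount Q k
count-related {A = A} {B = B} {P = P} {Q = Q} R total onto functional injective (xs , xs! , ∈⇔ , len)
  with images xs xs! (λ {x} → to (∈⇔ x))
  where
  images : ∀ xs → Unique xs → (∀ {x} → x ∈ xs → P x) →
           ∃ λ ys → Unique ys × length ys ≡ length xs ×
             (∀ {y} → y ∈ ys → Q y × ∃ λ x → x ∈ xs × R x y) ×
             (∀ {x y} → x ∈ xs → R x y → y ∈ ys)
  images [] _ _ = [] , [] , refl , (λ ()) , λ ()
  images (x ∷ xs) (x∉xs ∷ xs!) P-xs with total (P-xs (here refl)) | images xs xs! (P-xs ∘ there)
  ... | y , Rxy , Qy | ys , ys! , len , back , forth =
    y ∷ ys ,
    -- If `y` were already listed, injectivity would make `x` occur again in `xs`.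
    (All.tabulate (λ y′∈ys → λ { refl →
      let _ , x′ , x′∈xs , Rx′y = back y′∈ys in All.lookup x∉xs x′∈xs (injective Rxy Rx′y) }) ∷ ys!) ,
    cong suc len ,
    (λ { (here refl)  → Qy , x , here refl , Rxy
       ; (there y′∈) → let Qy′ , x′ , x′∈ , Rx′y′ = back y′∈ in Qy′ , x′ , there x′∈ , Rx′y′ }) ,
    λ { (here refl) Rxy′ → here (functional Rxy′ Rxy)
      ; (there x∈) Rxy′ → there (forth x∈ Rxy′) }
... | ys , ys! , len′ , back , forth = ys , ys! ,
  (λ y → mk⇔ (proj₁ ∘ back) λ Qy → let x , Rxy , Px = onto Qy in forth (from (∈⇔ x) Px) Rxy) ,
  trans len′ len

count-encoded : (C : Graph (suc n) → Set) {D : Pred (Vec Step n) 0ℓ} →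
                (∀ {G : Graph (suc n)} → C G → Reduced G) → (∀ {w} → D w → MotzkinFrom 0 w) →
                (∀ {w a} → Encodes w a → C (Γ a) ⇔ D w) →
                HasCount D k → CountUnitInterval (suc n) C k
count-encoded C C⇒reduced D⇒motzkin C⇔D = count-related Encodes
  (λ {w} Dw → let a , enc = motzkin⇒encodes w (D⇒motzkin Dw) in
    a , enc , area enc , from (C⇔D enc) Dw)
  (λ {a} (area , Ca) → let w , enc = reduced⇒encodes a area (C⇒reduced {Γ a} Ca) in
    w , enc , to (C⇔D enc) Ca)
  encodes-functional encodes-injective

-- Enumerating and counting step words

allSteps-complete : ∀ s → s ∈ allSteps
allSteps-complete up   = here refl
allSteps-complete down = there (here refl)
allSteps-complete flat = there (there (here refl))

allWords-complete : (w : Vec Step k) → w ∈ allWords k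
allWords-complete []      = here refl
allWords-complete (s ∷ w) =
  ∈-cartesianProductWith⁺ _∷_ (allSteps-complete s) (allWords-complete w)

allWords-unique : ∀ k → Unique (allWords k)
allWords-unique zero    = [] ∷ []
allWords-unique (suc k) = Unique.cartesianProductWith⁺ _∷_ Vec.∷-injective
  (((λ ()) ∷ (λ ()) ∷ []) ∷ ((λ ()) ∷ []) ∷ [] ∷ []) (allWords-unique k)

count-filter : {P : Pred (Vec Step k) 0ℓ} (P? : Decidable P) →
               HasCount P (length (filter P? (allWords k)))
count-filter {k = k} P? = filter P? (allWords k) ,
  Unique.filter⁺ P? (allWords-unique k) ,
  (λ w → mk⇔ (λ w∈ → proj₂ (∈-filter⁻ P? {xs = allWords k} w∈)) (∈-filter⁺ P? (allWords-complete w))) ,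
  refl

count-resp : {P Q : Pred A 0ℓ} → P ≐ Q → HasCount P k → HasCount Q k
count-resp (P⊆Q , Q⊆P) (xs , xs! , ∈⇔ , len) =
  xs , xs! , (λ x → mk⇔ (P⊆Q ∘ to (∈⇔ x)) (from (∈⇔ x) ∘ Q⊆P)) , len

count-none : {P : Pred A 0ℓ} → (∀ x → ¬ P x) → HasCount P 0
count-none ¬P = [] , [] , (λ x → mk⇔ (λ ()) λ Px → contradiction Px (¬P x)) , refl

count-[] : {P : Pred (Vec A 0) 0ℓ} → P [] → HasCount P 1
count-[] P[] = [] ∷ [] , [] ∷ [] , (λ { [] → mk⇔ (λ _ → P[]) λ _ → here refl }) , refl

-- Words are sorted by first step; the three resulting lists are disjoint because their heads
-- differ.
count-∷ : {P : Pred (Vec Step (suc k)) 0ℓ} → ∀ {u d f} →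
          HasCount (P ∘ (up ∷_)) u → HasCount (P ∘ (down ∷_)) d → HasCount (P ∘ (flat ∷_)) f →
          HasCount P (u + (d + f))
count-∷ {k = k} {P = P} (us , us! , us⇔ , refl) (ds , ds! , ds⇔ , refl) (fs , fs! , fs⇔ , refl) =
  all ,
  Unique.++⁺ (map! us!) (Unique.++⁺ (map! ds!) (map! fs!) (disjoint λ ()))
    (λ (w∈us , w∈) → [ (λ w∈ds → disjoint (λ ()) (w∈us , w∈ds)) ,
                       (λ w∈fs → disjoint (λ ()) (w∈us , w∈fs)) ]′
                     (∈-++⁻ (map (down ∷_) ds) w∈)) ,
  (λ w → mk⇔ (sound w) (complete w)) ,
  trans (length-++ (map (up ∷_) us)) (cong₂ _+_ (length-map _ us)
    (trans (length-++ (map (down ∷_) ds)) (cong₂ _+_ (length-map _ ds) (length-map _ fs))))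
  where
  all = map (up ∷_) us ++ map (down ∷_) ds ++ map (flat ∷_) fs
  map! : ∀ {s} {ws : List (Vec Step k)} → Unique ws → Unique (map (s ∷_) ws)
  map! = Unique.map⁺ Vec.∷-injectiveʳ
  disjoint : ∀ {s t} → s ≢ t → ∀ {ws vs : List (Vec Step k)} {w} →
             ¬ (w ∈ map (s ∷_) ws × w ∈ map (t ∷_) vs)
  disjoint s≢t (w∈ , w∈′) with ∈-map⁻ _ w∈ | ∈-map⁻ _ w∈′
  ... | _ , _ , eq | _ , _ , eq′ = s≢t (Vec.∷-injectiveˡ (trans (sym eq) eq′))
  lift : ∀ {s} {ws : List (Vec Step k)} → (∀ w → w ∈ ws ⇔ P (s ∷ w)) → ∀ {w} → w ∈ map (s ∷_) ws → P w
  lift ws⇔ w∈ with ∈-map⁻ _ w∈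
  ... | v , v∈ , refl = to (ws⇔ v) v∈
  sound : ∀ w → w ∈ all → P w
  sound w w∈ with ∈-++⁻ (map (up ∷_) us) w∈
  ... | inj₁ w∈us = lift us⇔ w∈us
  ... | inj₂ w∈′ with ∈-++⁻ (map (down ∷_) ds) w∈′
  ...   | inj₁ w∈ds = lift ds⇔ w∈ds
  ...   | inj₂ w∈fs = lift fs⇔ w∈fs
  complete : ∀ w → P w → w ∈ all
  complete (up ∷ w)   p = ∈-++⁺ˡ (∈-map⁺ (up ∷_) (from (us⇔ w) p))
  complete (down ∷ w) p = ∈-++⁺ʳ (map (up ∷_) us) (∈-++⁺ˡ (∈-map⁺ (down ∷_) (from (ds⇔ w) p)))
  complete (flat ∷ w) p = ∈-++⁺ʳ (map (up ∷_) us) (∈-++⁺ʳ (map (down ∷_) ds) (∈-map⁺ (flat ∷_) (from (fs⇔ w) p)))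

-- Motzkin paths of height at most 1

LowMotzkin : ℕ → ∀ {k} → Pred (Vec Step k) 0ℓ
LowMotzkin h w = MotzkinFrom h w × LowFrom h w

LowRiordan : ℕ → ∀ {k} → Pred (Vec Step k) 0ℓ
LowRiordan h w = NoFlatAtZeroFrom h w × LowMotzkin h w

low-motzkin-0 : ∀ {x y} → HasCount (LowMotzkin 0 {k}) x → HasCount (LowMotzkin 1 {k}) y →
                HasCount (LowMotzkin 0 {suc k}) (y + x)
low-motzkin-0 at0 at1 = count-∷
  (count-resp ((λ (m , low) → m , z≤n , low) , λ (m , _ , low) → m , low) at1)
  (count-none λ _ ())
  (count-resp ((λ (m , low) → m , z≤n , low) , λ (m , _ , low) → m , low) at0)

low-motzkin-1 : ∀ {x y} → HasCount (LowMotzkin 0 {k}) x → HasCount (LowMotzkin 1 {k}) y →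
                HasCount (LowMotzkin 1 {suc k}) (x + y)
low-motzkin-1 at0 at1 = count-∷
  (count-none λ { w (_ , _ , low) → contradiction (low⇒≤1 w low) λ { (s≤s ()) } })
  (count-resp ((λ (m , low) → m , ≤-refl , low) , λ (m , _ , low) → m , low) at0)
  (count-resp ((λ (m , low) → m , ≤-refl , low) , λ (m , _ , low) → m , low) at1)

-- From either height exactly one step leads to each of the heights 0 and 1, so both new counts are
-- the sum of the two old ones. The counts 1 and 0 at length 0 differ; from length 1 on they agree
-- and double.
count-low-motzkin : ∀ k → HasCount (LowMotzkin 0 {suc k}) (2 ^ k) ×
                          HasCount (LowMotzkin 1 {suc k}) (2 ^ k)
count-low-motzkin zero = low-motzkin-0 at0 at1 , low-motzkin-1 at0 at1
  where
  at0 = count-[] {P = LowMotzkin 0} (refl , z≤n)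
  at1 = count-none {P = LowMotzkin 1} λ { [] () }
count-low-motzkin (suc k) =
  let at0 , at1 = count-low-motzkin k
      double = cong (2 ^ k +_) (sym (+-identityʳ (2 ^ k)))
  in subst (HasCount _) double (low-motzkin-0 at0 at1) ,
     subst (HasCount _) double (low-motzkin-1 at0 at1)

-- At height 0 both `down` and `flat` are excluded, so the path begins with `up`.
low-riordan-0 : ∀ {y} → HasCount (LowRiordan 1 {k}) y → HasCount (LowRiordan 0 {suc k}) y
low-riordan-0 {y = y} at1 = subst (HasCount _) (+-identityʳ y) (count-∷
  (count-resp ((λ (r , m , low) → r , m , z≤n , low) , λ (r , m , _ , low) → r , m , low) at1)
  (count-none λ _ ())
  (count-none λ { _ ((0≢0 , _) , _) → 0≢0 refl }))

low-riordan-1 : ∀ {x y} → HasCount (LowRiordan 0 {k}) x → HasCount (LowRiordan 1 {k}) y →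
                HasCount (LowRiordan 1 {suc k}) (x + y)
low-riordan-1 at0 at1 = count-∷
  (count-none λ { w (_ , _ , _ , low) → contradiction (low⇒≤1 w low) λ { (s≤s ()) } })
  (count-resp ((λ (r , m , low) → r , m , ≤-refl , low) , λ (r , m , _ , low) → r , m , low) at0)
  (count-resp ((λ (r , m , low) → ((λ ()) , r) , m , ≤-refl , low) ,
               λ ((_ , r) , m , _ , low) → r , m , low) at1)

count-low-riordan-[] : HasCount (LowRiordan 0 {0}) 1
count-low-riordan-[] = count-[] (tt , refl , z≤n)

-- With at least two steps left at height 1, a path either goes flat or goes down and at once up
-- again: the Fibonacci recurrence, started by the counts 0 and 1.
count-low-riordan : ∀ k → HasCount (LowRiordan 1 {k}) (fib k)
count-low-riordan 0       = count-none λ { [] (_ , () , _) }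
count-low-riordan 1       = low-riordan-1 count-low-riordan-[] (count-low-riordan 0)
count-low-riordan (suc (suc k)) = subst (HasCount _) (+-comm (fib k) (fib (suc k)))
  (low-riordan-1 (low-riordan-0 (count-low-riordan k)) (count-low-riordan (suc k)))

-- The four families of graphs

count-reduced : HasCount (MotzkinFrom 0 {n}) k → CountUnitInterval (suc n) Reduced k
count-reduced = count-encoded Reduced id id λ enc →
  mk⇔ (λ _ → encodes⇒motzkin enc) λ _ → encodes⇒reduced enc

count-connected : HasCount (λ (w : Vec Step n) → MotzkinFrom 0 w × NoFlatAtZeroFrom 0 w) k →
                  CountUnitInterval (suc n) (λ G → Connected G × Reduced G) k
count-connected = count-encoded (λ G → Connected G × Reduced G) proj₂ proj₁ λ enc → mk⇔
  (λ (conn , _) → encodes⇒motzkin enc , to (connected⇔noFlat enc) conn)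
  (λ (_ , noFlat) → from (connected⇔noFlat enc) noFlat , encodes⇒reduced enc)

count-nested : HasCount (LowMotzkin 0 {n}) k →
               CountUnitInterval (suc n) (λ G → Reduced G × TwoNested G) k
count-nested = count-encoded (λ G → Reduced G × TwoNested G) proj₁ proj₁ λ enc → mk⇔
  (λ (_ , nested) → encodes⇒motzkin enc , to (twoNested⇔low enc) nested)
  (λ (_ , low) → encodes⇒reduced enc , from (twoNested⇔low enc) low)

count-connected-nested : HasCount (LowRiordan 0 {n}) k →
                         CountUnitInterval (suc n) (λ G → Connected G × Reduced G × TwoNested G) k
count-connected-nested = count-encoded (λ G → Connected G × Reduced G × TwoNested G)
  (proj₁ ∘ proj₂) (proj₁ ∘ proj₂) λ enc → mk⇔
  (λ (conn , _ , nested) →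
    to (connected⇔noFlat enc) conn , encodes⇒motzkin enc , to (twoNested⇔low enc) nested)
  (λ (noFlat , _ , low) →
    from (connected⇔noFlat enc) noFlat , encodes⇒reduced enc , from (twoNested⇔low enc) low)

area-[] : IsAreaSequence []
area-[] = (λ ()) , λ ()

proposition6p2 : ( CountUnitInterval 0 Reduced 1
    × (∀ n → CountUnitInterval (1 + n) Reduced (motzkin n)) )
    ×
    ( CountUnitInterval 0 (λ G → Connected G × Reduced G) 0
    × (∀ n → CountUnitInterval (1 + n) (λ G → Connected G × Reduced G) (riordan n)) )
    ×
    ( CountUnitInterval 0 (λ G → Reduced G × TwoNested G) 1
    × CountUnitInterval 1 (λ G → Reduced G × TwoNested G) 1
    × (∀ n → CountUnitInterval (2 + n) (λ G → Reduced G × TwoNested G) (2 ^ n)) )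
    ×
    ( CountUnitInterval 0 (λ G → Connected G × Reduced G × TwoNested G) 0
    × CountUnitInterval 1 (λ G → Connected G × Reduced G × TwoNested G) 1
    × (∀ n → CountUnitInterval (2 + n) (λ G → Connected G × Reduced G × TwoNested G) (fib n)) )
proposition6p2 =
  (count-[] (area-[] , λ ()) ,
   λ n → count-reduced (count-filter (motzkinFrom? 0))) ,
  (count-none (λ { _ (_ , (() , _) , _) }) ,
   λ n → count-connected (count-filter λ w → motzkinFrom? 0 w ×-dec noFlatAtZeroFrom? 0 w)) ,
  (count-[] (area-[] , (λ ()) , λ ()) ,
   count-nested (count-[] (refl , z≤n)) ,
   λ n → count-nested (proj₁ (count-low-motzkin n))) ,
  (count-none (λ { _ (_ , (() , _) , _) }) ,
   count-connected-nested count-low-riordan-[] ,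
   -- The word has length n + 1; its forced initial `up` leaves n steps from height 1.
   λ n → count-connected-nested (low-riordan-0 (count-low-riordan n)))
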